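{- Let $G$ be a finite bipartite graph with parts $L\sqcup R$, left-regular of degree $d$, let $n=|L|$, and let $s,h$ be positive integers with $s\ge 2$ and $\max(s,h)\le n$. If $h\ge s$ then $$\alpha_G(h)\ge d-\frac{h-1}{s-1}\bigl(d-\alpha_G(s)\bigr).$$ In particular, if $G$ is an $s$-optimal small-set expander of left degree $d$, then $$\alpha_G(h)\ge d-\frac{h-1}{s}$$ for every integer $h$ with $s\le h\le n$.
   Context: Graphs are finite and simple. A bipartite graph $G$ with parts $L\sqcup R$ is left-regular of degree $d$ if every vertex of $L$ has exactly $d$ incident edges. For $X\subseteq L$, $N(X)\subseteq R$ is the set of vertices adjacent to at least one vertex of $X$. For an integer $1\le t\le |L|$, $$\alpha_G(t):=\min\left\{\frac{|N(X)|}{|X|}: X\subseteq L,\ 0<|X|\le t\right\}.$$ A left-regular bipartite graph $G$ of degree $d$ is an $s$-optimal small-set expander if $\alpha_G(t)\ge (d-1)+\frac1t$ for every integer $t$ with $1\le t\le s$. -}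

module Defs where

open import Level using (0ℓ)
open import Data.Nat using (ℕ; zero; suc; _≤_; _<_; _≤?_; _<?_; NonZero; >-nonZero)
open import Data.Integer using (+_)
open import Data.Rational as ℚ using (ℚ; 0ℚ; 1ℚ; _/_; _-_; _+_)
open import Data.Rational.Properties using (≤-decTotalOrder)
open import Data.Fin using (Fin)
open import Data.Fin.Properties using (any?)
open import Data.Fin.Subset using (Subset; inside; outside; _∈_; ∣_∣)
open import Data.Fin.Subset.Properties using (_∈?_)
open import Data.List using (List; []; _∷_; _++_; map; mapMaybe)
open import Relation.Binary.Bundles using (DecTotalOrder)
open import Data.List.Extrema (DecTotalOrder.totalOrder ≤-decTotalOrder) using (min)
open import Data.Maybe using (Maybe; just; nothing)
open import Data.Product using (_×_; _,_; ∃-syntax)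
open import Data.Vec using ([]; _∷_; tabulate)
open import Relation.Binary.Core using (REL)
open import Relation.Binary.Definitions using (Decidable)
open import Relation.Binary.PropositionalEquality using (_≡_)
open import Relation.Nullary using (does; yes; no)
open import Relation.Nullary.Decidable using (_×-dec_)
import Relation.Unary as U

-- The parts are L = Fin n and R = Fin m.  Simplicity is automatic: a pair is
-- either adjacent or not, and adjacency only relates L to R.
record BipartiteGraph (n m : ℕ) : Set₁ where
  field
    Adj  : REL (Fin n) (Fin m) 0ℓ
    Adj? : Decidable Adj

fromDec : ∀ {n} {P : U.Pred (Fin n) 0ℓ} → U.Decidable P → Subset n
fromDec P? = tabulate (λ i → does (P? i))

allSubsets : ∀ n → List (Subset n)
allSubsets zero    = [] ∷ []
allSubsets (suc n) = map (outside ∷_) (allSubsets n) ++ map (inside ∷_) (allSubsets n)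

-- The value on the empty list is junk.
minimum : List ℚ → ℚ
minimum []       = 0ℚ
minimum (q ∷ qs) = min q qs

module _ {n m : ℕ} (G : BipartiteGraph n m) where
  open BipartiteGraph G

  degree : Fin n → ℕ
  degree u = ∣ fromDec (Adj? u) ∣

  LeftRegular : ℕ → Set
  LeftRegular d = ∀ u → degree u ≡ d

  N : Subset n → Subset m
  N X = fromDec {P = λ v → ∃[ u ] (u ∈ X × Adj u v)}
                (λ v → any? (λ u → (u ∈? X) ×-dec Adj? u v))

  ratio : ℕ → Subset n → Maybe ℚ
  ratio t X with (0 <? ∣ X ∣) ×-dec (∣ X ∣ ≤? t)
  ... | yes (0<∣X∣ , _) = just ((+ ∣ N X ∣ / ∣ X ∣) {{>-nonZero 0<∣X∣}})
  ... | no  _           = nothing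

  -- For t ≥ 1 and n ≥ 1 the singletons are admissible, so the minimum is taken
  -- over a nonempty list and the junk value of `minimum` is not used.
  α : ℕ → ℚ
  α t = minimum (mapMaybe (ratio t) (allSubsets n))

  record IsOptimalSmallSetExpander (d s : ℕ) : Set where
    field
      leftRegular : LeftRegular d
      expansion   : ∀ t → .{{_ : NonZero t}} → t ≤ s →
                    α t ℚ.≥ ((+ d / 1) - 1ℚ) + (+ 1 / t)

{-# OPTIONS --safe #-}

-- Let f(X) = d|X| − |N(X)| = Σ_v (deg_X v − 1)⁺ be the deficit of X.  A vertex v with
-- deg_X v = c ≥ 2 contributes (k − 1)c − k ≥ (k − 2)(c − 1) to Σ_{u ∈ X} f(X ∖ {u}), where
-- k = |X|, so Σ_{u ∈ X} f(X ∖ {u}) ≥ (k − 2) f(X).  Hence a bound f(Y) ≤ M |Y|(|Y| − 1) for all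
-- Y of size s ≥ 2 propagates by induction to all larger sets.  At size s it holds with
-- M = (d − α(s)) / (s − 1); dividing by |X| ≤ h gives the theorem, since sets of size at most
-- s even satisfy f(X) ≤ (d − α(s)) |X|.
module Submission where

open import Defs
open import Data.Bool using (Bool; true; false; _∧_; _∨_)
open import Data.Fin using (Fin; zero; suc)
open import Data.Fin.Properties using (any?)
open import Data.Fin.Subset using (Subset; inside; outside; ∣_∣; ⁅_⁆)
open import Data.Fin.Subset.Properties using (_∈?_; ∣⁅x⁆∣≡1)
import Data.Integer as ℤ
import Data.Integer.Properties as ℤ
import Data.Integer.Tactic.RingSolver as ℤ
open import Data.List using (List; []; _∷_; map; length; mapMaybe)
open import Data.List.Membership.Propositional using (_∈_; lose)
open import Data.List.Membership.Propositional.Properties using (∈-++⁺ˡ; ∈-++⁺ʳ; ∈-map⁺)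
open import Data.List.Properties using (map-∘; length-map)
open import Data.List.Relation.Unary.All as All using (All; []; _∷_)
import Data.List.Relation.Unary.All.Properties as All
open import Data.List.Relation.Unary.Any using (here; there)
import Data.List.Relation.Unary.Any.Properties as Any
import Data.Maybe.Relation.Unary.All as Maybe
import Data.Maybe.Relation.Unary.Any as MaybeAny
open import Data.Nat as ℕ using (ℕ; zero; suc; s≤s; z≤n)
open import Data.Nat.ListAction using () renaming (sum to sumᴸ)
import Data.Nat.Properties as ℕ
open import Data.Nat.Tactic.RingSolver using (solve-∀)
open import Data.Product using (Σ; ∃-syntax; _×_; _,_)
import Data.Rational.Properties as ℚ
open import Data.Rational.Solver using (module +-*-Solver)
open import Data.Rational.Unnormalised as ℚᵘ using (mkℚᵘ; *≡*; *≤*)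
import Data.Rational.Unnormalised.Properties as ℚᵘ
open import Data.Sum using (inj₁; inj₂)
open import Data.Vec using ([]; _∷_)
open import Function using (_∘_; id)
open import Level using (0ℓ)
open import Relation.Binary.Bundles using (DecTotalOrder)
open import Relation.Binary.PropositionalEquality
open import Relation.Nullary using (does; yes; no; contradiction)
open import Relation.Nullary.Decidable using (_×-dec_)
import Relation.Unary as U
open import Data.List.Extrema (DecTotalOrder.totalOrder ℚ.≤-decTotalOrder) using (min≤⊤; min≤xs; argmin-sel)

private variable
  A B : Set
  n m : ℕ

module _ where
  open import Data.Nat
  open import Data.Nat.Properties
  open import Algebra.Properties.Semiring.Sum +-*-semiring
    using (sum; sum-cong-≗; ∑-distrib-+; *-distribˡ-sum; sum-replicate-zero)

  -- Sums over lists and over `Fin`.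

  total : List A → (A → ℕ) → ℕ
  total xs f = sumᴸ (map f xs)

  total-map : (g : A → B) (xs : List A) (f : B → ℕ) → total (map g xs) f ≡ total xs (f ∘ g)
  total-map g xs f = cong sumᴸ (sym (map-∘ xs))

  total-cong : (xs : List A) {f g : A → ℕ} → (∀ x → f x ≡ g x) → total xs f ≡ total xs g
  total-cong []       f≗g = refl
  total-cong (x ∷ xs) f≗g = cong₂ _+_ (f≗g x) (total-cong xs f≗g)

  total-const : (xs : List A) (c : ℕ) → total xs (λ _ → c) ≡ length xs * c
  total-const []       c = refl
  total-const (x ∷ xs) c = cong (c +_) (total-const xs c)

  total-sum : (xs : List A) (f : A → Fin m → ℕ) →
              total xs (λ x → sum (f x)) ≡ sum (λ v → total xs (λ x → f x v))
  total-sum {m = m} []       f = sym (sum-replicate-zero m)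
  total-sum         (x ∷ xs) f =
    trans (cong (sum (f x) +_) (total-sum xs f)) (sym (∑-distrib-+ (f x) _))

  -- Averaging: pointwise bounds with common `a` and `b` are added up. In use, the list holds the
  -- deletions of a set, which all have the same size.
  total-lower-bound : ∀ {a b} c (f : A → ℕ) {xs} → All (λ x → a ≤ c * f x + b) xs →
                      length xs * a ≤ c * total xs f + length xs * b
  total-lower-bound c f [] = z≤n
  total-lower-bound {a = a} {b} c f {x ∷ xs} (p ∷ ps) = begin
    a + length xs * a                                        ≤⟨ +-mono-≤ p (total-lower-bound c f ps) ⟩
    (c * f x + b) + (c * total xs f + length xs * b)         ≡⟨ rearrange c (f x) b (total xs f) (length xs * b) ⟩
    c * (f x + total xs f) + (b + length xs * b)             ∎
    where
    open ≤-Reasoning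
    rearrange : ∀ c y b t l → (c * y + b) + (c * t + l) ≡ c * (y + t) + (b + l)
    rearrange = solve-∀

  sum-mono-≤ : {f g : Fin m → ℕ} → (∀ v → f v ≤ g v) → sum f ≤ sum g
  sum-mono-≤ {zero}  f≤g = z≤n
  sum-mono-≤ {suc m} f≤g = +-mono-≤ (f≤g zero) (sum-mono-≤ (f≤g ∘ suc))

  -- Elements and one-point deletions of a subset.

  elements : Subset n → List (Fin n)
  elements []            = []
  elements (outside ∷ X) = map suc (elements X)
  elements (inside  ∷ X) = zero ∷ map suc (elements X)

  deletions : Subset n → List (Subset n)
  deletions []            = []
  deletions (outside ∷ X) = map (outside ∷_) (deletions X)
  deletions (inside  ∷ X) = (outside ∷ X) ∷ map (inside ∷_) (deletions X)

  length-elements : (X : Subset n) → length (elements X) ≡ ∣ X ∣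
  length-elements []            = refl
  length-elements (outside ∷ X) = trans (length-map suc (elements X)) (length-elements X)
  length-elements (inside  ∷ X) = cong suc (trans (length-map suc (elements X)) (length-elements X))

  length-deletions : (X : Subset n) → length (deletions X) ≡ ∣ X ∣
  length-deletions []            = refl
  length-deletions (outside ∷ X) = trans (length-map _ (deletions X)) (length-deletions X)
  length-deletions (inside  ∷ X) = cong suc (trans (length-map _ (deletions X)) (length-deletions X))

  ∣deletions∣ : (X : Subset n) → All (λ Y → suc ∣ Y ∣ ≡ ∣ X ∣) (deletions X)
  ∣deletions∣ []            = []
  ∣deletions∣ (outside ∷ X) = All.map⁺ (∣deletions∣ X)
  ∣deletions∣ (inside  ∷ X) = refl ∷ All.map⁺ (All.map (cong suc) (∣deletions∣ X))

  -- Contacts of a single right vertex with a set.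

  bit : Bool → ℕ
  bit false = 0
  bit true  = 1

  -- With `a` the neighbourhood of a right vertex v, this is the Boolean test for v ∈ N(X). It
  -- recurses along `X` just as `elements` and `deletions` do, so that one induction can compare all
  -- three.
  meets : Subset n → (Fin n → Bool) → Bool
  meets []      a = false
  meets (b ∷ X) a = (b ∧ a zero) ∨ meets X (a ∘ suc)

  meets≤count : (X : Subset n) (a : Fin n → Bool) → bit (meets X a) ≤ total (elements X) (bit ∘ a)
  meets≤count []            a = z≤n
  meets≤count (outside ∷ X) a rewrite total-map suc (elements X) (bit ∘ a) = meets≤count X (a ∘ suc)
  meets≤count (inside ∷ X)  a rewrite total-map suc (elements X) (bit ∘ a) with a zero
  ... | false = meets≤count X (a ∘ suc)
  ... | true  = s≤s z≤n

  -- For the set `a` of neighbours of v, the total counts the u ∈ X with v ∈ N(X ∖ {u});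
  -- the only u that can fail is a unique neighbour of v in X.
  meets-deletions : (X : Subset n) (a : Fin n → Bool) →
                    total (deletions X) (λ Y → bit (meets Y a)) + 2 * bit (meets X a)
                    ≤ total (elements X) (bit ∘ a) + ∣ X ∣ * bit (meets X a)
  meets-deletions []            a = z≤n
  meets-deletions (outside ∷ X) a
    rewrite total-map suc (elements X) (bit ∘ a)
          | total-map (outside ∷_) (deletions X) (λ Y → bit (meets Y a))
    = meets-deletions X (a ∘ suc)
  meets-deletions (inside ∷ X)  a
    rewrite total-map suc (elements X) (bit ∘ a)
          | total-map (inside ∷_) (deletions X) (λ Y → bit (meets Y a))
    with a zero
  -- The new point lies outside `a`: its own deletion adds `r` on the left, and the larger
  -- cardinality adds the same `r` on the right.
  ... | false = begin
    (r + S) + 2 * r   ≡⟨ +-assoc r S (2 * r) ⟩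
    r + (S + 2 * r)   ≤⟨ +-monoʳ-≤ r (meets-deletions X (a ∘ suc)) ⟩
    r + (c + k * r)   ≡⟨ swap r c (k * r) ⟩
    c + (r + k * r)   ∎
    where
    open ≤-Reasoning
    r = bit (meets X (a ∘ suc))
    S = total (deletions X) (λ Y → bit (meets Y (a ∘ suc)))
    c = total (elements X) (bit ∘ a ∘ suc)
    k = ∣ X ∣
    swap : ∀ x y z → x + (y + z) ≡ y + (x + z)
    swap = solve-∀
  -- The new point lies in `a`: every deletion keeping it meets `a` and counts 1. The deletion of
  -- the point itself counts `r`, which is at most the number `c` of the other neighbours.
  ... | true = begin
    (r + total (deletions X) (λ _ → 1)) + 2 ≡⟨ cong (λ z → (r + z) + 2) (trans (total-const (deletions X) 1) (cong (_* 1) (length-deletions X))) ⟩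
    (r + k * 1) + 2                         ≤⟨ +-monoˡ-≤ 2 (+-monoˡ-≤ (k * 1) (meets≤count X (a ∘ suc))) ⟩
    (c + k * 1) + 2                         ≡⟨ rearrange c (k * 1) ⟩
    (1 + c) + (1 + k * 1)                   ∎
    where
    open ≤-Reasoning
    r = bit (meets X (a ∘ suc))
    c = total (elements X) (bit ∘ a ∘ suc)
    k = ∣ X ∣
    rearrange : ∀ c l → (c + l) + 2 ≡ (1 + c) + (1 + l)
    rearrange = solve-∀

  -- Neighbourhood sizes by double counting.

  ∣fromDec∣ : {P : U.Pred (Fin n) 0ℓ} (P? : U.Decidable P) → ∣ fromDec P? ∣ ≡ sum (bit ∘ does ∘ P?)
  ∣fromDec∣ {zero}  P? = refl
  ∣fromDec∣ {suc n} P? with does (P? zero)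
  ... | false = ∣fromDec∣ (P? ∘ suc)
  ... | true  = cong suc (∣fromDec∣ (P? ∘ suc))

  -- Stated for any `Q?` with the right Boolean values, so that the induction can pass to
  -- `Q? ∘ suc`; for the predicate in `N` these values agree by computation.
  does-any : {Q : U.Pred (Fin n) 0ℓ} (Q? : U.Decidable Q) (X : Subset n) (a : Fin n → Bool) →
             (∀ u → does (Q? u) ≡ does (u ∈? X) ∧ a u) → does (any? Q?) ≡ meets X a
  does-any Q? []            a eq = refl
  does-any Q? (outside ∷ X) a eq = cong₂ _∨_ (eq zero) (does-any (Q? ∘ suc) X (a ∘ suc) (eq ∘ suc))
  does-any Q? (inside  ∷ X) a eq = cong₂ _∨_ (eq zero) (does-any (Q? ∘ suc) X (a ∘ suc) (eq ∘ suc))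

  module _ (G : BipartiteGraph n m) where
    open BipartiteGraph G

    adjacentTo : Fin m → Fin n → Bool
    adjacentTo v u = does (Adj? u v)

    ∣N∣ : ∀ X → ∣ N G X ∣ ≡ sum (λ v → bit (meets X (adjacentTo v)))
    ∣N∣ X = trans (∣fromDec∣ (λ v → any? (λ u → (u ∈? X) ×-dec Adj? u v)))
                  (sum-cong-≗ (λ v → cong bit (does-any _ X (adjacentTo v) (λ u → refl))))

    module _ {d : ℕ} (regular : LeftRegular G d) where

      -- Counts the edges leaving `X` from both ends: by right vertices on the left-hand side, and
      -- by the `d` edges at each element of `X` after exchanging the sums.
      countEdges : ∀ X → sum (λ v → total (elements X) (bit ∘ adjacentTo v)) ≡ ∣ X ∣ * d
      countEdges X = begin
        sum (λ v → total (elements X) (bit ∘ adjacentTo v))           ≡⟨ total-sum (elements X) (λ u v → bit (adjacentTo v u)) ⟨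
        total (elements X) (λ u → sum (λ v → bit (adjacentTo v u)))   ≡⟨ total-cong (elements X) (λ u → trans (sym (∣fromDec∣ (Adj? u))) (regular u)) ⟩
        total (elements X) (λ _ → d)                                  ≡⟨ total-const (elements X) d ⟩
        length (elements X) * d                                       ≡⟨ cong (_* d) (length-elements X) ⟩
        ∣ X ∣ * d                                                     ∎
        where open ≡-Reasoning

      ∣N∣≤ : ∀ X → ∣ N G X ∣ ≤ ∣ X ∣ * d
      ∣N∣≤ X = begin
        ∣ N G X ∣                                            ≡⟨ ∣N∣ X ⟩
        sum (λ v → bit (meets X (adjacentTo v)))             ≤⟨ sum-mono-≤ (λ v → meets≤count X (adjacentTo v)) ⟩
        sum (λ v → total (elements X) (bit ∘ adjacentTo v))  ≡⟨ countEdges X ⟩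
        ∣ X ∣ * d                                            ∎
        where open ≤-Reasoning

      -- `meets-deletions` summed over all right vertices. In terms of the deficit f and k = |X|
      -- this says that the deficits of the deletions sum to at least (k - 2) f(X), with all
      -- subtractions moved across.
      N-deletions : ∀ X → total (deletions X) (λ Y → ∣ N G Y ∣) + 2 * ∣ N G X ∣
                          ≤ ∣ X ∣ * d + ∣ X ∣ * ∣ N G X ∣
      N-deletions X = begin
        total (deletions X) (λ Y → ∣ N G Y ∣) + 2 * ∣ N G X ∣      ≡⟨ cong₂ _+_ (trans (total-cong (deletions X) ∣N∣) (total-sum (deletions X) hit)) (scale 2) ⟩
        sum (λ v → total (deletions X) (λ Y → hit Y v)) + sum (λ v → 2 * hit X v)
                                                                   ≡⟨ ∑-distrib-+ (λ v → total (deletions X) (λ Y → hit Y v)) _ ⟨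
        sum (λ v → total (deletions X) (λ Y → hit Y v) + 2 * hit X v)
                                                                   ≤⟨ sum-mono-≤ (λ v → meets-deletions X (adjacentTo v)) ⟩
        sum (λ v → total (elements X) (bit ∘ adjacentTo v) + ∣ X ∣ * hit X v)
                                                                   ≡⟨ ∑-distrib-+ (λ v → total (elements X) (bit ∘ adjacentTo v)) _ ⟩
        sum (λ v → total (elements X) (bit ∘ adjacentTo v)) + sum (λ v → ∣ X ∣ * hit X v)
                                                                   ≡⟨ cong₂ _+_ (countEdges X) (sym (scale ∣ X ∣)) ⟩
        ∣ X ∣ * d + ∣ X ∣ * ∣ N G X ∣                              ∎
        where
        open ≤-Reasoning
        hit : Subset n → Fin m → ℕ
        hit Y v = bit (meets Y (adjacentTo v))
        scale : ∀ c → c * ∣ N G X ∣ ≡ sum (λ v → c * hit X v)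
        scale c = trans (cong (c *_) (∣N∣ X)) (*-distribˡ-sum c (hit X))

      -- Propagation of deficit bounds to larger sets.

      -- c (d|X| − |N(X)|) ≤ e |X| (|X| − 1), with the subtraction moved across.
      DeficitBound : ℕ → ℕ → Subset n → Set
      DeficitBound c e X = c * (∣ X ∣ * d) ≤ c * ∣ N G X ∣ + ∣ X ∣ * (pred ∣ X ∣ * e)

      -- Summing the hypothesis over the `3 + i` deletions bounds their total deficit from above,
      -- and `N-deletions` bounds it from below. The common factor k - 2 = `suc i` is positive and
      -- cancels.
      deficit-step : ∀ c e i X → ∣ X ∣ ≡ 3 + i →
                     (∀ Y → ∣ Y ∣ ≡ 2 + i → DeficitBound c e Y) → DeficitBound c e X
      deficit-step c e i X ∣X∣≡ ih rewrite ∣X∣≡ = *-cancelˡ-≤ (suc i) (+-cancelʳ-≤ z _ _ (begin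
        suc i * (c * (k * d)) + z                                  ≡⟨ lhs c i d x ⟩
        k * (c * ((2 + i) * d)) + c * (2 * x)                      ≤⟨ +-monoˡ-≤ (c * (2 * x)) average ⟩
        c * t + k * ((2 + i) * (suc i * e)) + c * (2 * x)          ≡⟨ mid c t (k * ((2 + i) * (suc i * e))) x ⟩
        c * (t + 2 * x) + k * ((2 + i) * (suc i * e))              ≤⟨ +-monoˡ-≤ _ (*-monoʳ-≤ c step) ⟩
        c * (k * d + k * x) + k * ((2 + i) * (suc i * e))          ≡⟨ rhs c i d x e ⟩
        suc i * (c * x + k * ((2 + i) * e)) + z                    ∎))
        where
        open ≤-Reasoning
        k = 3 + i
        x = ∣ N G X ∣
        t = total (deletions X) (λ Y → ∣ N G Y ∣)
        -- Added to both sides to avoid subtraction: it raises the coefficient of `c * (k * d)` from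
        -- k - 2 to k - 1 and that of `c * x` from k - 2 to k.
        z = c * (k * d) + c * (2 * x)
        step : t + 2 * x ≤ k * d + k * x
        step = subst (λ l → t + 2 * x ≤ l * d + l * x) ∣X∣≡ (N-deletions X)
        average : k * (c * ((2 + i) * d)) ≤ c * t + k * ((2 + i) * (suc i * e))
        average = subst (λ l → l * (c * ((2 + i) * d)) ≤ c * t + l * ((2 + i) * (suc i * e)))
          (trans (length-deletions X) ∣X∣≡)
          (total-lower-bound c (λ Y → ∣ N G Y ∣) (All.map bound (∣deletions∣ X)))
          where
          bound : ∀ {Y} → suc ∣ Y ∣ ≡ ∣ X ∣ →
                  c * ((2 + i) * d) ≤ c * ∣ N G Y ∣ + (2 + i) * (suc i * e)
          bound {Y} eq = subst (λ l → c * (l * d) ≤ c * ∣ N G Y ∣ + l * (pred l * e)) ∣Y∣≡ (ih Y ∣Y∣≡)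
            where
            ∣Y∣≡ : ∣ Y ∣ ≡ 2 + i
            ∣Y∣≡ = suc-injective (trans eq ∣X∣≡)
        lhs : ∀ c i d x → suc i * (c * ((3 + i) * d)) + (c * ((3 + i) * d) + c * (2 * x))
                          ≡ (3 + i) * (c * ((2 + i) * d)) + c * (2 * x)
        lhs = solve-∀
        mid : ∀ c t r x → c * t + r + c * (2 * x) ≡ c * (t + 2 * x) + r
        mid = solve-∀
        rhs : ∀ c i d x e → c * ((3 + i) * d + (3 + i) * x) + (3 + i) * ((2 + i) * (suc i * e))
                            ≡ suc i * (c * x + (3 + i) * ((2 + i) * e)) + (c * ((3 + i) * d) + c * (2 * x))
        rhs = solve-∀

      -- Writing the size as `2 + (j + s)` makes the successor case fit the `3 + i` of
      -- `deficit-step` by computation.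
      deficit-bound : ∀ c e s → (∀ Y → ∣ Y ∣ ≡ 2 + s → DeficitBound c e Y) →
                      ∀ j X → ∣ X ∣ ≡ 2 + (j + s) → DeficitBound c e X
      deficit-bound c e s base zero    X ∣X∣≡ = base X ∣X∣≡
      deficit-bound c e s base (suc j) X ∣X∣≡ =
        deficit-step c e (j + s) X ∣X∣≡ (deficit-bound c e s base j)

      -- Here 2 + s is the paper's s.  With α(2 + s) = p / q, the hypothesis `expands` says that every set of size at
      -- most 2 + s expands by p / q, and e / q is d − α(2 + s).
      module _ (s p q : ℕ) (p≤qd : p ≤ q * d)
               (expands : ∀ X → 0 < ∣ X ∣ → ∣ X ∣ ≤ 2 + s → p * ∣ X ∣ ≤ ∣ N G X ∣ * q) where

        private
          -- The truncated subtraction is exact by `p≤qd`. The quotient of `e` by `c` is the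
          -- constant M = (d - α(2 + s)) / (1 + s).
          e = q * d ∸ p
          c = suc s * q

        -- This is `expands` rewritten for deficits and multiplied by `suc s`. At size exactly
        -- `2 + s` the factor `suc s` equals |X| - 1, which gives the base case of the induction.
        small-set-deficit : ∀ X → 0 < ∣ X ∣ → ∣ X ∣ ≤ 2 + s →
                            c * (∣ X ∣ * d) ≤ c * ∣ N G X ∣ + ∣ X ∣ * (suc s * e)
        small-set-deficit X pos ∣X∣≤ = begin
          c * (k * d)                    ≡⟨ reorder s q k d ⟩
          suc s * (k * (q * d))          ≡⟨ cong (λ z → suc s * (k * z)) (m+[n∸m]≡n p≤qd) ⟨
          suc s * (k * (p + e))          ≡⟨ distrib s k p e ⟩
          suc s * (p * k) + k * (suc s * e)
                                         ≤⟨ +-monoˡ-≤ _ (*-monoʳ-≤ (suc s) (expands X pos ∣X∣≤)) ⟩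
          suc s * (x * q) + k * (suc s * e)
                                         ≡⟨ collect s q x (k * (suc s * e)) ⟩
          c * x + k * (suc s * e)        ∎
          where
          open ≤-Reasoning
          k = ∣ X ∣
          x = ∣ N G X ∣
          reorder : ∀ s q k d → (suc s * q) * (k * d) ≡ suc s * (k * (q * d))
          reorder = solve-∀
          distrib : ∀ s k p e → suc s * (k * (p + e)) ≡ suc s * (p * k) + k * (suc s * e)
          distrib = solve-∀
          collect : ∀ s q x r → suc s * (x * q) + r ≡ (suc s * q) * x + r
          collect = solve-∀

        -- Sets of size at most `2 + s` carry the factor `suc s`, larger ones the factor |X| - 1;
        -- both factors are at most `h ∸ 1`.
        deficit-≤ : ∀ {h} → 2 + s ≤ h → ∀ X → 0 < ∣ X ∣ → ∣ X ∣ ≤ h →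
                    c * (∣ X ∣ * d) ≤ c * ∣ N G X ∣ + ∣ X ∣ * ((h ∸ 1) * e)
        deficit-≤ {h} s≤h X pos ∣X∣≤h with ≤-total ∣ X ∣ (2 + s)
        ... | inj₁ ∣X∣≤s = ≤-trans (small-set-deficit X pos ∣X∣≤s)
              (+-monoʳ-≤ (c * ∣ N G X ∣) (*-monoʳ-≤ ∣ X ∣ (*-monoˡ-≤ e (∸-monoˡ-≤ 1 s≤h))))
        ... | inj₂ s≤∣X∣ = ≤-trans (deficit-bound c e s base (∣ X ∣ ∸ (2 + s)) X ∣X∣≡)
              (+-monoʳ-≤ (c * ∣ N G X ∣) (*-monoʳ-≤ ∣ X ∣ (*-monoˡ-≤ e (pred-mono-≤ ∣X∣≤h))))
          where
          ∣X∣≡ : ∣ X ∣ ≡ 2 + (∣ X ∣ ∸ (2 + s) + s)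
          ∣X∣≡ = trans (sym (m∸n+n≡m s≤∣X∣)) (trans (+-suc _ (suc s)) (cong suc (+-suc _ s)))
          base : ∀ Y → ∣ Y ∣ ≡ 2 + s → DeficitBound c e Y
          base Y ∣Y∣≡ = subst (λ k → c * (∣ Y ∣ * d) ≤ c * ∣ N G Y ∣ + ∣ Y ∣ * (k * e))
            (cong pred (sym ∣Y∣≡))
            (small-set-deficit Y (subst (0 <_) (sym ∣Y∣≡) (s≤s z≤n)) (≤-reflexive ∣Y∣≡))

-- Transfer between natural and rational inequalities.

open import Data.Nat using (ℕ; _≤_; _∸_; _⊔_; NonZero; >-nonZero)
open import Data.Integer using (+_)
open import Data.Nat.Properties using (m<n⇒0<n∸m)
open import Data.Rational as ℚ using (ℚ; _/_; _-_; _*_; _+_; 1ℚ; toℚᵘ; Positive)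

ι : ℕ → ℚ
ι k = + k / 1

-- Since `/` reduces to lowest terms, numerators and denominators are hidden behind a gcd. The
-- lemmas below therefore compute with the unreduced fraction and carry the result back.
toℚᵘ-/ : ∀ p q → toℚᵘ (+ p / suc q) ℚᵘ.≃ mkℚᵘ (+ p) q
toℚᵘ-/ p q = ℚ.toℚᵘ-fromℚᵘ (mkℚᵘ (+ p) q)

/-cancel-≤ : ∀ p q a b .{{_ : NonZero q}} .{{_ : NonZero b}} →
             + p / q ℚ.≤ + a / b → p ℕ.* b ≤ a ℕ.* q
/-cancel-≤ p (suc q) a (suc b) le = ℤ.drop‿+≤+ (subst₂ ℤ._≤_ (sym (ℤ.pos-* p (suc b))) (sym (ℤ.pos-* a (suc q)))
  (ℚᵘ.drop-*≤* (ℚᵘ.≤-respˡ-≃ (toℚᵘ-/ p q) (ℚᵘ.≤-respʳ-≃ (toℚᵘ-/ a b) (ℚ.toℚᵘ-mono-≤ le)))))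

ι-mono-≤ : ∀ {a b} → a ≤ b → ι a ℚ.≤ ι b
ι-mono-≤ {a} {b} a≤b = ℚ.toℚᵘ-cancel-≤
  (ℚᵘ.≤-respˡ-≃ (ℚᵘ.≃-sym (toℚᵘ-/ a 0)) (ℚᵘ.≤-respʳ-≃ (ℚᵘ.≃-sym (toℚᵘ-/ b 0))
    (*≤* (ℤ.*-monoʳ-≤-nonNeg (+ 1) (ℤ.+≤+ a≤b)))))

ι-+ : ∀ a b → ι (a ℕ.+ b) ≡ ι a + ι b
ι-+ a b = ℚ.toℚᵘ-injective (begin
  toℚᵘ (ι (a ℕ.+ b))               ≈⟨ toℚᵘ-/ (a ℕ.+ b) 0 ⟩
  mkℚᵘ (+ (a ℕ.+ b)) 0             ≈⟨ *≡* (trans (cong (ℤ._* + 1) (ℤ.pos-+ a b)) (distrib (+ a) (+ b))) ⟩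
  mkℚᵘ (+ a) 0 ℚᵘ.+ mkℚᵘ (+ b) 0   ≈⟨ ℚᵘ.+-cong (toℚᵘ-/ a 0) (toℚᵘ-/ b 0) ⟨
  toℚᵘ (ι a) ℚᵘ.+ toℚᵘ (ι b)       ≈⟨ ℚ.toℚᵘ-homo-+ (ι a) (ι b) ⟨
  toℚᵘ (ι a + ι b)                 ∎)
  where
  open ℚᵘ.≃-Reasoning
  distrib : ∀ x y → (x ℤ.+ y) ℤ.* + 1 ≡ (x ℤ.* + 1 ℤ.+ y ℤ.* + 1) ℤ.* + 1
  distrib = ℤ.solve-∀

ι-* : ∀ a b → ι (a ℕ.* b) ≡ ι a * ι b
ι-* a b = ℚ.toℚᵘ-injective (begin
  toℚᵘ (ι (a ℕ.* b))               ≈⟨ toℚᵘ-/ (a ℕ.* b) 0 ⟩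
  mkℚᵘ (+ (a ℕ.* b)) 0             ≈⟨ *≡* (cong (ℤ._* + 1) (ℤ.pos-* a b)) ⟩
  mkℚᵘ (+ a) 0 ℚᵘ.* mkℚᵘ (+ b) 0   ≈⟨ ℚᵘ.*-cong (toℚᵘ-/ a 0) (toℚᵘ-/ b 0) ⟨
  toℚᵘ (ι a) ℚᵘ.* toℚᵘ (ι b)       ≈⟨ ℚ.toℚᵘ-homo-* (ι a) (ι b) ⟨
  toℚᵘ (ι a * ι b)                 ∎)
  where open ℚᵘ.≃-Reasoning

/-*-ι : ∀ p q .{{_ : NonZero q}} → (+ p / q) * ι q ≡ ι p
/-*-ι p (suc q) = ℚ.toℚᵘ-injective (begin
  toℚᵘ ((+ p / suc q) * ι (suc q))            ≈⟨ ℚ.toℚᵘ-homo-* (+ p / suc q) (ι (suc q)) ⟩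
  toℚᵘ (+ p / suc q) ℚᵘ.* toℚᵘ (ι (suc q))    ≈⟨ ℚᵘ.*-cong (toℚᵘ-/ p q) (toℚᵘ-/ (suc q) 0) ⟩
  mkℚᵘ (+ p) q ℚᵘ.* mkℚᵘ (+ suc q) 0          ≈⟨ *≡* (trans (ℤ.*-assoc (+ p) (+ suc q) (+ 1)) (cong (λ z → + p ℤ.* z) (sym (ℤ.pos-* (suc q) 1)))) ⟩
  mkℚᵘ (+ p) 0                                ≈⟨ toℚᵘ-/ p 0 ⟨
  toℚᵘ (ι p)                                  ∎)
  where open ℚᵘ.≃-Reasoning

ι-pos : ∀ k .{{_ : NonZero k}} → Positive (ι k)
ι-pos k = ℚ.normalize-pos k 1

≤+⇒-≤ : ∀ x y z → x ℚ.≤ y + z → x - z ℚ.≤ y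
≤+⇒-≤ x y z x≤y+z =
  subst (x - z ℚ.≤_) (solve 2 (λ a b → a :+ b :- b := a) refl y z) (ℚ.+-monoˡ-≤ (ℚ.- z) x≤y+z)
  where open +-*-Solver

-- The minimum in `α` and its attainment.

minimum-∈ : ∀ {q} qs → q ∈ qs → minimum qs ∈ qs
-- The membership premise excludes the empty list, where `minimum` takes its junk value.
minimum-∈ (r ∷ rs) _ with argmin-sel id r rs
... | inj₁ eq = here eq
... | inj₂ r∈ = there r∈

minimum-≤ : ∀ {q} qs → q ∈ qs → minimum qs ℚ.≤ q
minimum-≤ (r ∷ rs) (here refl) = min≤⊤ r rs
minimum-≤ (r ∷ rs) (there q∈)  = All.lookup (min≤xs r rs) q∈

∈-allSubsets : (X : Subset n) → X ∈ allSubsets n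
∈-allSubsets []            = here refl
∈-allSubsets (outside ∷ X) = ∈-++⁺ˡ (∈-map⁺ (outside ∷_) (∈-allSubsets X))
∈-allSubsets {suc n} (inside ∷ X) =
  ∈-++⁺ʳ (map (outside ∷_) (allSubsets n)) (∈-map⁺ (inside ∷_) (∈-allSubsets X))

module _ (G : BipartiteGraph n m) where

  expansionRatio : (X : Subset n) → .(0 ℕ.< ∣ X ∣) → ℚ
  expansionRatio X pos = (+ ∣ N G X ∣ / ∣ X ∣) {{>-nonZero pos}}

  IsRatioUpTo : ℕ → ℚ → Set
  IsRatioUpTo t q = ∃[ X ] Σ (0 ℕ.< ∣ X ∣) λ pos → ∣ X ∣ ≤ t × q ≡ expansionRatio X pos

  ratio-sound : ∀ t X → Maybe.All (IsRatioUpTo t) (ratio G t X)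
  ratio-sound t X with (0 ℕ.<? ∣ X ∣) ×-dec (∣ X ∣ ℕ.≤? t)
  ... | yes (pos , ≤t) = Maybe.just (X , pos , ≤t , refl)
  ... | no _           = Maybe.nothing

  ratio-complete : ∀ t X (pos : 0 ℕ.< ∣ X ∣) → ∣ X ∣ ≤ t →
                   MaybeAny.Any (expansionRatio X pos ≡_) (ratio G t X)
  ratio-complete t X pos ≤t with (0 ℕ.<? ∣ X ∣) ×-dec (∣ X ∣ ℕ.≤? t)
  -- Two positivity proofs meet here, but the fraction depends on them only irrelevantly, so `refl`
  -- applies.
  ... | yes _ = MaybeAny.just refl
  ... | no ¬p = contradiction (pos , ≤t) ¬p

  ∈-ratios : ∀ t X (pos : 0 ℕ.< ∣ X ∣) → ∣ X ∣ ≤ t →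
             expansionRatio X pos ∈ mapMaybe (ratio G t) (allSubsets n)
  ∈-ratios t X pos ≤t = Any.mapMaybe⁺ (ratio G t) (allSubsets n)
    (Any.map⁺ (lose (∈-allSubsets X) (ratio-complete t X pos ≤t)))

  α-≤ : ∀ t X (pos : 0 ℕ.< ∣ X ∣) → ∣ X ∣ ≤ t → α G t ℚ.≤ expansionRatio X pos
  α-≤ t X pos ≤t = minimum-≤ _ (∈-ratios t X pos ≤t)

  -- A singleton is admissible because `1 ≤ n` and `1 ≤ t`, so the list of ratios is nonempty and
  -- its minimum is one of its entries.
  α-attained : ∀ t → 1 ≤ n → 1 ≤ t → IsRatioUpTo t (α G t)
  α-attained t (s≤s _) 1≤t =
    All.lookup (All.mapMaybe⁺ (All.map⁺ (All.universal (ratio-sound t) (allSubsets n))))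
               (minimum-∈ _ (∈-ratios t ⁅ zero ⁆ (ℕ.≤-reflexive (sym ∣x∣)) (ℕ.≤-trans (ℕ.≤-reflexive ∣x∣) 1≤t)))
    where
    ∣x∣ = ∣⁅x⁆∣≡1 {n} zero

  -- Lower bounds for `α`.

  module _ {d : ℕ} (regular : LeftRegular G d) (s h : ℕ) (s≤n : 2 ℕ.+ s ≤ n) (s≤h : 2 ℕ.+ s ≤ h) where

    -- The set `X₀` attaining α(2 + s) supplies the fraction `p` / `q` needed by `deficit-≤`.
    -- Multiplication by `K`, the product of `suc s`, `q` and `k`, clears every denominator and
    -- leaves that inequality between natural numbers.
    ratio-bound : ∀ X₀ (X₀-pos : 0 ℕ.< ∣ X₀ ∣) → α G (2 ℕ.+ s) ≡ expansionRatio X₀ X₀-pos →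
                  ∀ X (X-pos : 0 ℕ.< ∣ X ∣) → ∣ X ∣ ≤ h →
                  ι d - (+ (h ∸ 1) / suc s) * (ι d - α G (2 ℕ.+ s)) ℚ.≤ expansionRatio X X-pos
    ratio-bound X₀ X₀-pos αs≡ X X-pos ∣X∣≤h =
      ≤+⇒-≤ (ι d) x (w * δ) (ℚ.*-cancelʳ-≤-pos (ι K) {{ι-pos K}} (begin
        ι d * ι K                                      ≡⟨ ι-* d K ⟨
        ι (d ℕ.* K)                                    ≡⟨ cong ι (reorder d (suc s) q k) ⟩
        ι (c ℕ.* (k ℕ.* d))                            ≤⟨ ι-mono-≤ (deficit-≤ G regular s p q p≤qd expands s≤h X X-pos ∣X∣≤h) ⟩
        ι (c ℕ.* a ℕ.+ k ℕ.* ((h ∸ 1) ℕ.* e))          ≡⟨ ι-+ (c ℕ.* a) (k ℕ.* ((h ∸ 1) ℕ.* e)) ⟩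
        ι (c ℕ.* a) + ι (k ℕ.* ((h ∸ 1) ℕ.* e))        ≡⟨ cong₂ _+_ ca≡ khe≡ ⟩
        (ι (suc s) * ι q) * (x * ι k) + ι k * ((w * ι (suc s)) * (δ * ι q))
                                                       ≡⟨ collect (ι (suc s)) (ι q) x (ι k) w δ ⟩
        (x + w * δ) * ((ι (suc s) * ι q) * ι k)        ≡⟨ cong ((x + w * δ) *_) (trans (ι-* c k) (cong (_* ι k) (ι-* (suc s) q))) ⟨
        (x + w * δ) * ι K                              ∎))
      where
      open ℚ.≤-Reasoning
      open +-*-Solver
      p = ∣ N G X₀ ∣
      q = ∣ X₀ ∣
      k = ∣ X ∣
      a = ∣ N G X ∣
      e = q ℕ.* d ∸ p
      c = suc s ℕ.* q
      K = c ℕ.* k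
      x = expansionRatio X X-pos
      w = + (h ∸ 1) / suc s
      δ = ι d - α G (2 ℕ.+ s)
      instance
        q≢0 : NonZero q
        q≢0 = >-nonZero X₀-pos
        k≢0 : NonZero k
        k≢0 = >-nonZero X-pos
        K≢0 : NonZero K
        K≢0 = ℕ.m*n≢0 c k {{ℕ.m*n≢0 (suc s) q}}
      p≤qd : p ≤ q ℕ.* d
      p≤qd = ∣N∣≤ G regular X₀
      -- Minimality of α(2 + s), cross-multiplied.
      expands : ∀ Y → 0 ℕ.< ∣ Y ∣ → ∣ Y ∣ ≤ 2 ℕ.+ s → p ℕ.* ∣ Y ∣ ≤ ∣ N G Y ∣ ℕ.* q
      expands Y pos ∣Y∣≤s = /-cancel-≤ p q (∣ N G Y ∣) (∣ Y ∣) {{q≢0}} {{>-nonZero pos}}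
        (subst (ℚ._≤ expansionRatio Y pos) αs≡ (α-≤ (2 ℕ.+ s) Y pos ∣Y∣≤s))
      reorder : ∀ d s q k → d ℕ.* ((s ℕ.* q) ℕ.* k) ≡ (s ℕ.* q) ℕ.* (k ℕ.* d)
      reorder = solve-∀
      collect : ∀ s q x k w δ → (s * q) * (x * k) + k * ((w * s) * (δ * q)) ≡ (x + w * δ) * ((s * q) * k)
      collect = solve 6 (λ s q x k w δ →
        (s :* q) :* (x :* k) :+ k :* ((w :* s) :* (δ :* q)) := (x :+ w :* δ) :* ((s :* q) :* k)) refl
      δq≡e : δ * ι q ≡ ι e
      δq≡e = begin-equality
        δ * ι q                            ≡⟨ solve 3 (λ d r q → (d :- r) :* q := q :* d :- r :* q) refl (ι d) (α G (2 ℕ.+ s)) (ι q) ⟩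
        ι q * ι d - α G (2 ℕ.+ s) * ι q    ≡⟨ cong₂ _-_ (sym (ι-* q d)) (trans (cong (_* ι q) αs≡) (/-*-ι p q)) ⟩
        ι (q ℕ.* d) - ι p                  ≡⟨ cong (λ z → ι z - ι p) (ℕ.m+[n∸m]≡n p≤qd) ⟨
        ι (p ℕ.+ e) - ι p                  ≡⟨ cong (_- ι p) (ι-+ p e) ⟩
        (ι p + ι e) - ι p                  ≡⟨ solve 2 (λ p e → p :+ e :- p := e) refl (ι p) (ι e) ⟩
        ι e                                ∎
      ca≡ : ι (c ℕ.* a) ≡ (ι (suc s) * ι q) * (x * ι k)
      ca≡ = trans (ι-* c a) (cong₂ _*_ (ι-* (suc s) q) (sym (/-*-ι a k)))
      khe≡ : ι (k ℕ.* ((h ∸ 1) ℕ.* e)) ≡ ι k * ((w * ι (suc s)) * (δ * ι q))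
      khe≡ = trans (ι-* k ((h ∸ 1) ℕ.* e)) (cong (ι k *_)
        (trans (ι-* (h ∸ 1) e) (cong₂ _*_ (sym (/-*-ι (h ∸ 1) (suc s))) (sym δq≡e))))

    -- It is enough to bound the ratio of one set `X` that attains α(h).
    α-bound : ι d - (+ (h ∸ 1) / suc s) * (ι d - α G (2 ℕ.+ s)) ℚ.≤ α G h
    α-bound =
      let 1≤n = ℕ.≤-trans (s≤s z≤n) s≤n
          X₀ , X₀-pos , _ , αs≡ = α-attained (2 ℕ.+ s) 1≤n (s≤s z≤n)
          X , X-pos , ∣X∣≤h , αh≡ = α-attained h 1≤n (ℕ.≤-trans (s≤s z≤n) s≤h)
      in subst (ι d - (+ (h ∸ 1) / suc s) * (ι d - α G (2 ℕ.+ s)) ℚ.≤_) (sym αh≡)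
               (ratio-bound X₀ X₀-pos αs≡ X X-pos ∣X∣≤h)

    -- Optimality gives d - α(2 + s) ≤ 1 - 1/(2 + s) = (1 + s)/(2 + s), and the numerator cancels
    -- the denominator `suc s` of `w`.
    α-bound-optimal : (ι d - 1ℚ) + (+ 1 / (2 ℕ.+ s)) ℚ.≤ α G (2 ℕ.+ s) → ι d - (+ (h ∸ 1) / (2 ℕ.+ s)) ℚ.≤ α G h
    α-bound-optimal opt = begin
      ι d - (+ (h ∸ 1) / (2 ℕ.+ s))      ≡⟨ cong (ι d -_) w*gap ⟨
      ι d - w * (1ℚ - r)                 ≤⟨ ℚ.+-monoʳ-≤ (ι d) (ℚ.neg-antimono-≤ (ℚ.*-monoˡ-≤-nonNeg w {{ℚ.normalize-nonNeg (h ∸ 1) (suc s)}} gap)) ⟩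
      ι d - w * (ι d - α G (2 ℕ.+ s))    ≤⟨ α-bound ⟩
      α G h                              ∎
      where
      open ℚ.≤-Reasoning
      open +-*-Solver
      w = + (h ∸ 1) / suc s
      r = + 1 / (2 ℕ.+ s)
      gap : ι d - α G (2 ℕ.+ s) ℚ.≤ 1ℚ - r
      gap = ≤+⇒-≤ (ι d) (1ℚ - r) (α G (2 ℕ.+ s)) (begin
        ι d                                ≡⟨ solve 3 (λ d r o → d := (o :- r) :+ ((d :- o) :+ r)) refl (ι d) r 1ℚ ⟩
        (1ℚ - r) + ((ι d - 1ℚ) + r)        ≤⟨ ℚ.+-monoʳ-≤ (1ℚ - r) opt ⟩
        (1ℚ - r) + α G (2 ℕ.+ s)           ∎)
      gap*s : (1ℚ - r) * ι (2 ℕ.+ s) ≡ ι (suc s)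
      gap*s = begin-equality
        (1ℚ - r) * ι (2 ℕ.+ s)             ≡⟨ solve 2 (λ r t → (con 1ℚ :- r) :* t := t :- r :* t) refl r (ι (2 ℕ.+ s)) ⟩
        ι (2 ℕ.+ s) - r * ι (2 ℕ.+ s)      ≡⟨ cong₂ _-_ (ι-+ 1 (suc s)) (/-*-ι 1 (2 ℕ.+ s)) ⟩
        (ι 1 + ι (suc s)) - ι 1            ≡⟨ solve 2 (λ o t → o :+ t :- o := t) refl (ι 1) (ι (suc s)) ⟩
        ι (suc s)                          ∎
      w*gap : w * (1ℚ - r) ≡ + (h ∸ 1) / (2 ℕ.+ s)
      -- Both denominators, `2 + s` and `suc s`, are multiplied out before comparing.
      w*gap = ι-*-cancelʳ (2 ℕ.+ s) (ι-*-cancelʳ (suc s) (begin-equality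
        w * (1ℚ - r) * ι (2 ℕ.+ s) * ι (suc s)     ≡⟨ solve 4 (λ w g t u → w :* g :* t :* u := (w :* u) :* (g :* t)) refl w (1ℚ - r) (ι (2 ℕ.+ s)) (ι (suc s)) ⟩
        (w * ι (suc s)) * ((1ℚ - r) * ι (2 ℕ.+ s)) ≡⟨ cong₂ _*_ (/-*-ι (h ∸ 1) (suc s)) gap*s ⟩
        ι (h ∸ 1) * ι (suc s)                      ≡⟨ cong (_* ι (suc s)) (/-*-ι (h ∸ 1) (2 ℕ.+ s)) ⟨
        (+ (h ∸ 1) / (2 ℕ.+ s)) * ι (2 ℕ.+ s) * ι (suc s) ∎))
        where
        ι-*-cancelʳ : ∀ k .{{_ : NonZero k}} {x y} → x * ι k ≡ y * ι k → x ≡ y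
        ι-*-cancelʳ k eq = ℚ.≤-antisym (ℚ.*-cancelʳ-≤-pos (ι k) {{ι-pos k}} (ℚ.≤-reflexive eq))
                                        (ℚ.*-cancelʳ-≤-pos (ι k) {{ι-pos k}} (ℚ.≤-reflexive (sym eq)))

theorem1p7 : ∀ {n m} (G : BipartiteGraph n m) (d : ℕ) → LeftRegular G d →
    ∀ s → .{{_ : NonZero s}} → (2≤s : 2 ≤ s) →
    (∀ h → .{{_ : NonZero h}} → s ⊔ h ≤ n → s ≤ h →
    α G h ℚ.≥ (+ d / 1) - (+ (h ∸ 1) / (s ∸ 1)) {{>-nonZero (m<n⇒0<n∸m 2≤s)}} * ((+ d / 1) - α G s))
    ×
    (IsOptimalSmallSetExpander G d s →
    ∀ h → s ≤ h → h ≤ n →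
    α G h ℚ.≥ (+ d / 1) - (+ (h ∸ 1) / s))
-- Matching on `2 ≤ s` replaces `s` by `2 + s`, so that `s ∸ 1` computes to `suc s`. In the second
-- part, optimality is applied at t = `2 + s`.
theorem1p7 G d regular (suc (suc s)) (s≤s (s≤s z≤n)) =
  (λ h s⊔h≤n s≤h → α-bound G regular s h (ℕ.≤-trans (ℕ.m≤m⊔n (2 ℕ.+ s) h) s⊔h≤n) s≤h) ,
  (λ optimal h s≤h h≤n → α-bound-optimal G regular s h (ℕ.≤-trans s≤h h≤n) s≤h
    (IsOptimalSmallSetExpander.expansion optimal (2 ℕ.+ s) ℕ.≤-refl))
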